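{- Let $n\ge 1$ and let $K_n$ be the complete simple undirected graph on $n$ vertices, with $q=n(n-1)/2$ edges. For every weight function $w:E(K_n)\to\{1,\ldots,q\}$ assigning different weights to different edges, there exists a strictly decreasing trail and a strictly increasing trail of length at least $n-1$; that is, $f_i(n)=f_d(n)\ge n-1$.
   Context: A trail of length $k\ge 0$ in a graph is a sequence $(e_1,\ldots,e_k)$ of distinct edges for which there is a sequence of vertices $(v_0,\ldots,v_k)$ with $e_i=v_{i-1}v_i$ for all $1\le i\le k$ (vertices may repeat; the empty trail has length $0$). With respect to a weight function $w$ on edges, a trail is strictly decreasing if $w(e_i)>w(e_{i+1})$, and strictly increasing if $w(e_i)<w(e_{i+1})$, for all $1\le i<k$. $P_i(w,G)$ (resp. $P_d(w,G)$) is the length of a longest strictly increasing (resp. strictly decreasing) trail in $G$. Define $f_i(n)=\min_w P_i(w,K_n)$ and $f_d(n)=\min_w P_d(w,K_n)$, the minimum being over all weight functions $w:E(K_n)\to\{1,\ldots,q\}$, $q=n(n-1)/2$, that assign different weights to different edges. -}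

module Defs where

open import Data.Fin as Fin using (Fin; inject₁)
open import Data.List as List using (List; length)
open import Data.List.Relation.Unary.Linked using (Linked)
open import Data.List.Relation.Unary.Unique.Propositional using (Unique)
open import Data.Nat using (ℕ; suc; _*_; _∸_; _≤_; _<_; _>_)
open import Data.Nat.DivMod using (_/_)
open import Data.Product using (∃; ∃-syntax; _×_)
open import Data.Sum using (_⊎_)
open import Data.Vec as Vec using (Vec)
open import Function.Definitions using (Injective)
open import Level using (0ℓ)
open import Relation.Binary.Core using (Rel)
open import Relation.Binary.Definitions using (Symmetric; Irreflexive)
open import Relation.Binary.PropositionalEquality using (_≡_; _≢_; ≢-sym)

record SimpleGraph (n : ℕ) : Set₁ where
  field
    Adj         : Rel (Fin n) 0ℓ
    symmetric   : Symmetric Adj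
    irreflexive : Irreflexive _≡_ Adj

open SimpleGraph public using (Adj)

K : (n : ℕ) → SimpleGraph n
K n = record
  { Adj         = _≢_
  ; symmetric   = ≢-sym
  ; irreflexive = λ i≡j i≢j → i≢j i≡j
  }

-- An undirected edge {u , v} is represented by its endpoints in increasing
-- order.  The proof fields are irrelevant, so two edges are equal exactly
-- when they have the same endpoints.
record Edge {n : ℕ} (G : SimpleGraph n) : Set where
  constructor edge
  field
    lo hi     : Fin n
    .lo<hi    : lo Fin.< hi
    .adjacent : Adj G lo hi

module _ {n : ℕ} {G : SimpleGraph n} where

  -- e = uv as an unordered pair.
  Joins : Edge G → Fin n → Fin n → Set
  Joins e u v = (lo ≡ u × hi ≡ v) ⊎ (lo ≡ v × hi ≡ u)
    where open Edge e

  record IsTrail (es : List (Edge G)) : Set where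
    field
      distinct : Unique es
      walk     : ∃[ vs ] ∀ (i : Fin (length es)) →
                   Joins (List.lookup es i)
                         (Vec.lookup {n = suc (length es)} vs (inject₁ i))
                         (Vec.lookup vs (Fin.suc i))

  StrictlyIncreasing : (Edge G → ℕ) → List (Edge G) → Set
  StrictlyIncreasing w = Linked (λ e e′ → w e < w e′)

  StrictlyDecreasing : (Edge G → ℕ) → List (Edge G) → Set
  StrictlyDecreasing w = Linked (λ e e′ → w e > w e′)

IsGreatest : (ℕ → Set) → ℕ → Set
IsGreatest S m = S m × (∀ k → S k → k ≤ m)

IsLeast : (ℕ → Set) → ℕ → Set
IsLeast S m = S m × (∀ k → S k → m ≤ k)

-- Maxima and minima are stated as relations: Pᵢ G w m says that a longest
-- strictly increasing trail exists and has length m; likewise Pd, fᵢ and fd.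
Pᵢ : ∀ {n} (G : SimpleGraph n) → (Edge G → ℕ) → ℕ → Set
Pᵢ G w = IsGreatest λ k →
  ∃[ es ] IsTrail {G = G} es × StrictlyIncreasing w es × length es ≡ k

Pd : ∀ {n} (G : SimpleGraph n) → (Edge G → ℕ) → ℕ → Set
Pd G w = IsGreatest λ k →
  ∃[ es ] IsTrail {G = G} es × StrictlyDecreasing w es × length es ≡ k

record WeightFunction (n : ℕ) : Set where
  field
    weight    : Edge (K n) → ℕ
    positive  : ∀ e → 1 ≤ weight e
    bounded   : ∀ e → weight e ≤ n * (n ∸ 1) / 2
    injective : Injective _≡_ _≡_ weight

open WeightFunction public using (weight)

fᵢ : ℕ → ℕ → Set
fᵢ n = IsLeast λ k → ∃[ w ] Pᵢ (K n) (weight {n} w) k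

fd : ℕ → ℕ → Set
fd n = IsLeast λ k → ∃[ w ] Pd (K n) (weight {n} w) k

{-# OPTIONS --safe #-}

-- A pedestrian stands on each vertex; the edges are called in order of
-- increasing weight, and the two pedestrians at the ends of the called edge
-- swap places along it.  Every edge is walked twice, so the n pedestrians
-- together walk n(n − 1) edges, and one of them walks a monotone trail of
-- length at least n − 1.
-- Reversing a trail exchanges increasing and decreasing, so fᵢ and fd agree;
-- the minimum exists because, up to pointwise equality, there are only finitely
-- many weight functions, and the longest trail for each is found by search.
module Submission where

open import Defs
open import Data.Fin as Fin using (Fin; inject₁; toℕ; fromℕ<; combine; remQuot; funToFin; finToFun)
open import Data.Fin.Permutation using (Permutation′; permutation)
open import Data.Fin.Properties as Fin
  using (any?; all?; ¬∀⟶∃¬; toℕ<n; toℕ-fromℕ<; toℕ-injective; remQuot-combine; finToFun-funToFin)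
open import Data.List as List using (List; []; _∷_; length; reverse; _ʳ++_)
open import Data.List.Properties using (length-reverse)
open import Data.List.Relation.Unary.AllPairs as AllPairs using ()
open import Data.List.Relation.Unary.Linked as Linked using (Linked; []; [-]; _∷_)
open import Data.List.Relation.Unary.Linked.Properties using (Linked⇒AllPairs)
open import Data.Nat
  using (ℕ; zero; suc; _+_; _*_; _∸_; _^_; _≤_; _<_; _≥_; _>_; z≤n; s≤s; s≤s⁻¹; _≟_; _≤?_; _<?_)
open import Data.Nat.DivMod using (_/_; m*n/n≡m)
open import Data.Nat.Properties
open import Data.Nat.Tactic.RingSolver using (solve-∀)
open import Data.Product using (∃; ∃-syntax; _×_; _,_; proj₁; proj₂; uncurry)
open import Data.Sum using (_⊎_; inj₁; inj₂; [_,_]′)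
open import Data.Vec as Vec using (Vec; []; _∷_)
open import Function using (_∘_; flip)
open import Function.Definitions using (Injective)
open import Level using (0ℓ)
open import Relation.Binary.Core using (Rel)
open import Relation.Binary.Definitions using (Transitive; Irreflexive; tri<; tri≈; tri>)
open import Relation.Binary.PropositionalEquality
open import Relation.Nullary using (Dec; yes; no; contradiction)
open import Relation.Nullary.Decidable using (map′; recompute; _×-dec_; _→-dec_)
open import Relation.Unary using (Decidable)
open import Algebra.Properties.CommutativeMonoid.Sum +-0-commutativeMonoid
  using (sum; sum-permute; sum-replicate-zero; ∑-distrib-+)

-- Greatest and least elements

module _ {S T : ℕ → Set} (S⇒T : ∀ {k} → S k → T k) (T⇒S : ∀ {k} → T k → S k) where

  IsGreatest-resp : ∀ {m} → IsGreatest S m → IsGreatest T m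
  IsGreatest-resp (Sm , max) = S⇒T Sm , λ k Tk → max k (T⇒S Tk)

  IsLeast-resp : ∀ {m} → IsLeast S m → IsLeast T m
  IsLeast-resp (Sm , min) = S⇒T Sm , λ k Tk → min k (T⇒S Tk)

IsGreatest-unique : ∀ {S k m} → IsGreatest S k → IsGreatest S m → k ≡ m
IsGreatest-unique (Sk , k-max) (Sm , m-max) = ≤-antisym (m-max _ Sk) (k-max _ Sm)

greatest : ∀ {S} → Decidable S → ∀ B → (∀ k → S k → k ≤ B) → ∃ S → ∃ (IsGreatest S)
greatest S? zero bound (k , Sk) with refl ← n≤0⇒n≡0 (bound k Sk) = 0 , Sk , bound
greatest S? (suc B) bound nonempty with S? (suc B)
... | yes SB = suc B , SB , bound
... | no ¬SB = greatest S? B bound′ nonempty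
  where
  bound′ : ∀ k → _ → k ≤ B
  bound′ k Sk = s≤s⁻¹ (≤∧≢⇒< (bound k Sk) λ { refl → ¬SB Sk })

least : ∀ {S} → Decidable S → ∀ k → S k → ∃ (IsLeast S)
least S? zero    S0 = 0 , S0 , λ _ _ → z≤n
least S? (suc k) Sk with S? 0
... | yes S0 = 0 , S0 , λ _ _ → z≤n
... | no ¬S0 with m , Sm , min ← least (S? ∘ suc) k Sk =
  suc m , Sm , λ { zero S0 → contradiction S0 ¬S0 ; (suc j) Sj → s≤s (min j Sj) }

-- Finite sums

sum-mono-≤ : ∀ {n} {f g : Fin n → ℕ} → (∀ i → f i ≤ g i) → sum f ≤ sum g
sum-mono-≤ {zero}  f≤g = z≤n
sum-mono-≤ {suc n} f≤g = +-mono-≤ (f≤g Fin.zero) (sum-mono-≤ (f≤g ∘ Fin.suc))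

sum-mono-< : ∀ {n} {f g : Fin n → ℕ} → 1 ≤ n → (∀ i → f i < g i) → sum f < sum g
sum-mono-< {suc n} _ f<g = +-mono-<-≤ (f<g Fin.zero) (sum-mono-≤ (<⇒≤ ∘ f<g ∘ Fin.suc))

-- An averaging argument: if `g i < f i` held at every index, the nonempty sums would compare
-- strictly the other way.
sum-≤⇒∃≤ : ∀ {n} {f g : Fin n → ℕ} → 1 ≤ n → sum f ≤ sum g → ∃[ i ] f i ≤ g i
sum-≤⇒∃≤ {n} {f} {g} n≥1 ∑f≤∑g with i , gi≮fi ← ¬∀⟶∃¬ n _ (λ i → g i <? f i)
  (λ g<f → <⇒≱ (sum-mono-< n≥1 g<f) ∑f≤∑g) = i , ≮⇒≥ gi≮fi

-- Meant for counts in which a single summand can go up, by one, from one round to the next.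
sum-≤-suc : ∀ {n} {f g : Fin n → ℕ} i → f i ≤ suc (g i) → (∀ j → j ≢ i → f j ≤ g j) →
            sum f ≤ suc (sum g)
sum-≤-suc Fin.zero    fi≤ f≤g = +-mono-≤ fi≤ (sum-mono-≤ λ j → f≤g (Fin.suc j) λ ())
sum-≤-suc (Fin.suc i) fi≤ f≤g = ≤-trans
  (+-mono-≤ (f≤g Fin.zero λ ()) (sum-≤-suc i fi≤ λ j j≢i → f≤g (Fin.suc j) (j≢i ∘ Fin.suc-injective)))
  (≤-reflexive (+-suc _ _))

𝟙 : ∀ {P : Set} → Dec P → ℕ
𝟙 (yes _) = 1
𝟙 (no _)  = 0

𝟙-mono : ∀ {P Q : Set} {P? : Dec P} {Q? : Dec Q} → (P → Q) → 𝟙 P? ≤ 𝟙 Q?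
𝟙-mono {P? = no _}              P⇒Q = z≤n
𝟙-mono {P? = yes p} {yes _}     P⇒Q = ≤-refl
𝟙-mono {P? = yes p} {no ¬q}     P⇒Q = contradiction (P⇒Q p) ¬q

𝟙≤1 : ∀ {P : Set} (P? : Dec P) → 𝟙 P? ≤ 1
𝟙≤1 (yes _) = ≤-refl
𝟙≤1 (no _)  = z≤n

-- Edges of the complete graph

module _ {n : ℕ} {G : SimpleGraph n} where

  -- The irrelevant proof stored in the edge can be rebuilt because the order on `Fin n` is
  -- decidable.
  lo<hi : (e : Edge G) → Edge.lo e Fin.< Edge.hi e
  lo<hi (edge lo hi lo<hi _) = recompute (lo Fin.<? hi) lo<hi

  joins-sym : ∀ (e : Edge G) {u v} → Joins e u v → Joins e v u
  joins-sym _ (inj₁ uv) = inj₂ uv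
  joins-sym _ (inj₂ vu) = inj₁ vu

  joins-≢ : ∀ (e : Edge G) {u v} → Joins e u v → u ≢ v
  joins-≢ e (inj₁ (refl , refl)) u≡v = Fin.<⇒≢ (lo<hi e) u≡v
  joins-≢ e (inj₂ (refl , refl)) u≡v = Fin.<⇒≢ (lo<hi e) (sym u≡v)

  joins-functional : ∀ (e : Edge G) {u v v′} → Joins e u v → Joins e u v′ → v ≡ v′
  joins-functional _ (inj₁ (refl , refl)) (inj₁ (_ , refl)) = refl
  joins-functional _ (inj₂ (refl , refl)) (inj₂ (refl , _)) = refl
  joins-functional e (inj₁ (refl , _)) (inj₂ (_ , eq)) = contradiction (sym eq) (Fin.<⇒≢ (lo<hi e))
  joins-functional e (inj₂ (_ , refl)) (inj₁ (eq , _)) = contradiction eq (Fin.<⇒≢ (lo<hi e))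

  joins-unique : ∀ (e e′ : Edge G) {u v} → Joins e u v → Joins e′ u v → e ≡ e′
  joins-unique _ _ (inj₁ (refl , refl)) (inj₁ (refl , refl)) = refl
  joins-unique _ _ (inj₂ (refl , refl)) (inj₂ (refl , refl)) = refl
  joins-unique e e′ (inj₁ (refl , refl)) (inj₂ (refl , refl)) =
    contradiction (lo<hi e) (<-asym (lo<hi e′))
  joins-unique e e′ (inj₂ (refl , refl)) (inj₁ (refl , refl)) =
    contradiction (lo<hi e) (<-asym (lo<hi e′))

join? : ∀ {n} (u v : Fin n) → u ≡ v ⊎ ∃[ e ] Joins {G = K n} e u v
join? u v with Fin.<-cmp u v
... | tri≈ _ u≡v _   = inj₁ u≡v
... | tri< u<v u≢v _ = inj₂ (edge u v u<v u≢v , inj₁ (refl , refl))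
... | tri> _ u≢v v<u = inj₂ (edge v u v<u (u≢v ∘ sym) , inj₂ (refl , refl))

_≟ᴱ_ : ∀ {n} (e e′ : Edge (K n)) → Dec (e ≡ e′)
e ≟ᴱ e′ = map′ (λ { (refl , refl) → refl }) (λ { refl → refl , refl })
  (Edge.lo e Fin.≟ Edge.lo e′ ×-dec Edge.hi e Fin.≟ Edge.hi e′)

-- Edges are searched through pairs of endpoints: by `joins-unique` a pair carries at most one edge,
-- so one test per pair settles it.
allEdges? : ∀ {n} {P : Edge (K n) → Set} → Decidable P → Dec (∀ e → P e)
allEdges? {n} {P} P? = map′
  (λ all e → all (Edge.lo e) (Edge.hi e) e (inj₁ (refl , refl)))
  (λ all u v e _ → all e)
  (all? λ u → all? λ v → joined? u v)
  where
  joined? : ∀ u v → Dec (∀ e → Joins e u v → P e)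
  joined? u v with join? u v
  ... | inj₁ u≡v     = yes λ e j → contradiction u≡v (joins-≢ e j)
  ... | inj₂ (e , j) = map′ (λ Pe e′ j′ → subst P (joins-unique e e′ j j′) Pe) (λ all → all e j) (P? e)

-- The adjacency matrix of weights, with junk value 0 on the diagonal.
matrix : ∀ {n} → (Edge (K n) → ℕ) → Fin n → Fin n → ℕ
matrix w u v = [ (λ _ → 0) , w ∘ proj₁ ]′ (join? u v)

module _ {n : ℕ} (w : Edge (K n) → ℕ) where

  matrix-view : ∀ u v → (u ≡ v × matrix w u v ≡ 0) ⊎ ∃[ e ] Joins e u v × matrix w u v ≡ w e
  matrix-view u v with join? u v
  ... | inj₁ u≡v     = inj₁ (u≡v , refl)
  ... | inj₂ (e , j) = inj₂ (e , j , refl)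

  matrix-joins : ∀ e {u v} → Joins e u v → matrix w u v ≡ w e
  matrix-joins e {u} {v} j with join? u v
  ... | inj₁ u≡v       = contradiction u≡v (joins-≢ e j)
  ... | inj₂ (e′ , j′) = cong w (joins-unique e′ e j′ j)

  matrix-sym : ∀ u v → matrix w u v ≡ matrix w v u
  matrix-sym u v with matrix-view u v
  ... | inj₁ (refl , _)    = refl
  ... | inj₂ (e , j , eq) = trans eq (sym (matrix-joins e (joins-sym e j)))

  matrix-≤ : ∀ {q} → (∀ e → w e ≤ q) → ∀ u v → matrix w u v ≤ q
  matrix-≤ w≤q u v with matrix-view u v
  ... | inj₁ (_ , eq)     = ≤-trans (≤-reflexive eq) z≤n
  ... | inj₂ (e , _ , eq) = ≤-trans (≤-reflexive eq) (w≤q e)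

  -- Positive weights keep the diagonal 0 apart from every edge; off the diagonal, equal entries
  -- come from the same edge, whose second end is determined by `u`.
  matrix-injective : (∀ e → 1 ≤ w e) → Injective _≡_ _≡_ w → ∀ u {v v′} →
                     matrix w u v ≡ matrix w u v′ → v ≡ v′
  matrix-injective w≥1 w-inj u {v} {v′} eq with matrix-view u v | matrix-view u v′
  ... | inj₁ (refl , _) | inj₁ (refl , _) = refl
  ... | inj₁ (_ , M≡0) | inj₂ (e , _ , M≡w) =
    contradiction (trans (sym M≡w) (trans (sym eq) M≡0)) (≢-sym (<⇒≢ (w≥1 e)))
  ... | inj₂ (e , _ , M≡w) | inj₁ (_ , M≡0) =
    contradiction (trans (sym M≡w) (trans eq M≡0)) (≢-sym (<⇒≢ (w≥1 e)))
  ... | inj₂ (e , j , M≡w) | inj₂ (e′ , j′ , M≡w′)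
    with refl ← w-inj (trans (sym M≡w) (trans eq M≡w′)) = joins-functional e j j′

-- Walks and their reversal

module _ {n : ℕ} {G : SimpleGraph n} where

  -- An inductive form of the vertex sequence of a trail, indexed by its starting vertex, so that
  -- edges can be put in front one at a time.
  data Walk : Fin n → List (Edge G) → Set where
    []  : ∀ {u} → Walk u []
    _∷_ : ∀ {e u v es} → Joins e u v → Walk v es → Walk u (e ∷ es)

  successors : ∀ {u es} → Walk u es → Vec (Fin n) (length es)
  successors []                = []
  successors (_∷_ {v = v} j p) = v ∷ successors p

  successors-joins : ∀ {u es} (p : Walk u es) (i : Fin (length es)) →
                     Joins (List.lookup es i)
                           (Vec.lookup (u ∷ successors p) (inject₁ i))
                           (Vec.lookup (u ∷ successors p) (Fin.suc i))
  successors-joins (j ∷ p) Fin.zero    = j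
  successors-joins (j ∷ p) (Fin.suc i) = successors-joins p i

  fromVertices : ∀ es (vs : Vec (Fin n) (suc (length es))) →
                 (∀ i → Joins (List.lookup es i)
                              (Vec.lookup vs (inject₁ i)) (Vec.lookup vs (Fin.suc i))) →
                 Walk (Vec.head vs) es
  fromVertices []       _            js = []
  fromVertices (e ∷ es) (u ∷ v ∷ vs) js = js Fin.zero ∷ fromVertices es (v ∷ vs) (js ∘ Fin.suc)

  walk : ∀ {es} → IsTrail es → ∃[ u ] Walk u es
  walk trail with vs , js ← IsTrail.walk trail = _ , fromVertices _ vs js

  walk-ʳ++ : ∀ {u es es′} → Walk u es → Walk u es′ → ∃[ v ] Walk v (es ʳ++ es′)
  walk-ʳ++ []              q = _ , q
  walk-ʳ++ (_∷_ {e} j p) q = walk-ʳ++ p (joins-sym e j ∷ q)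

  module _ {R : Rel (Edge G) 0ℓ} (R-trans : Transitive R) (R-irrefl : Irreflexive _≡_ R) where

    -- Transitivity relates any two edges of the list, not only neighbours, and irreflexivity then
    -- makes them distinct.
    monotone⇒trail : ∀ {u es} → Walk u es → Linked R es → IsTrail es
    monotone⇒trail p mono = record
      { distinct = AllPairs.map (λ Ree′ e≡e′ → R-irrefl e≡e′ Ree′) (Linked⇒AllPairs R-trans mono)
      ; walk     = _ ∷ successors p , successors-joins p
      }

linked-ʳ++ : ∀ {A : Set} {R : Rel A 0ℓ} {x : A} {xs ys} →
             Linked R (x ∷ xs) → Linked (flip R) (x ∷ ys) → Linked (flip R) ((x ∷ xs) ʳ++ ys)
linked-ʳ++ [-]        Rys = Rys
linked-ʳ++ (Rxy ∷ Rxs) Rys = linked-ʳ++ Rxs (Rxy ∷ Rys)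

linked-reverse : ∀ {A : Set} {R : Rel A 0ℓ} {xs} → Linked R xs → Linked (flip R) (reverse xs)
linked-reverse {xs = []}     _  = []
linked-reverse {xs = x ∷ xs} Rxs = linked-ʳ++ Rxs [-]

module _ {n : ℕ} {G : SimpleGraph n} (w : Edge G → ℕ) where

  HasIncreasing HasDecreasing : ℕ → Set
  HasIncreasing k = ∃[ es ] IsTrail es × StrictlyIncreasing w es × length es ≡ k
  HasDecreasing k = ∃[ es ] IsTrail es × StrictlyDecreasing w es × length es ≡ k

  increasing⇒trail : ∀ {u es} → Walk u es → StrictlyIncreasing w es → IsTrail es
  increasing⇒trail = monotone⇒trail <-trans (λ e≡e′ → <-irrefl (cong w e≡e′))

  decreasing⇒trail : ∀ {u es} → Walk u es → StrictlyDecreasing w es → IsTrail es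
  decreasing⇒trail = monotone⇒trail (flip <-trans) (λ e≡e′ → <-irrefl (cong w (sym e≡e′)))

  increasing⇒decreasing : ∀ {k} → HasIncreasing k → HasDecreasing k
  increasing⇒decreasing (es , trail , inc , len) =
    reverse es , decreasing⇒trail (proj₂ (walk-ʳ++ (proj₂ (walk trail)) [])) dec , dec ,
    trans (length-reverse es) len
    where dec = linked-reverse inc

  decreasing⇒increasing : ∀ {k} → HasDecreasing k → HasIncreasing k
  decreasing⇒increasing (es , trail , dec , len) =
    reverse es , increasing⇒trail (proj₂ (walk-ʳ++ (proj₂ (walk trail)) [])) inc , inc ,
    trans (length-reverse es) len
    where inc = linked-reverse dec

-- Searching for decreasing trails

module _ {n : ℕ} (w : Edge (K n) → ℕ) where

  -- Walks of `k` edges from `u` with decreasing weights, all below `b`. The bound carries the last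
  -- weight used, so each step is checked locally.
  data Descent (b : ℕ) (u : Fin n) : ℕ → Set where
    stop : Descent b u 0
    step : ∀ {e v k} → Joins e u v → w e < b → Descent (w e) v k → Descent b u (suc k)

  descent-weaken : ∀ {b c u k} → b ≤ c → Descent b u k → Descent c u k
  descent-weaken b≤c stop         = stop
  descent-weaken b≤c (step {e = e} j e<b d) = step {e = e} j (<-≤-trans e<b b≤c) d

  -- The weights are distinct naturals below `b`, so there are at most `b` of them.
  descent-≤ : ∀ {b u k} → Descent b u k → k ≤ b
  descent-≤ stop           = z≤n
  descent-≤ (step j e<b d) = ≤-<-trans (descent-≤ d) e<b

  descent? : ∀ b u k → Dec (Descent b u k)
  descent? b u zero    = yes stop
  descent? b u (suc k) = map′
    (λ { (v , e , j , e<b , d) → step {e = e} j e<b d })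
    (λ { (step {e = e} {v} j e<b d) → v , e , j , e<b , d })
    (any? step?)
    where
    step? : ∀ v → Dec (∃[ e ] Joins e u v × w e < b × Descent (w e) v k)
    step? v with join? u v
    ... | inj₁ u≡v     = no λ { (e , j , _) → joins-≢ e j u≡v }
    ... | inj₂ (e , j) = map′ (λ { (e<b , d) → e , j , e<b , d })
      (λ { (e′ , j′ , e<b , d) →
             subst (λ e → w e < b × Descent (w e) v k) (joins-unique e′ e j′ j) (e<b , d) })
      (w e <? b ×-dec descent? (w e) v k)

  edges : ∀ {b u k} → Descent b u k → List (Edge (K n))
  edges stop               = []
  edges (step {e = e} _ _ d) = e ∷ edges d

  edges-length : ∀ {b u k} (d : Descent b u k) → length (edges d) ≡ k
  edges-length stop         = refl
  edges-length (step _ _ d) = cong suc (edges-length d)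

  edges-walk : ∀ {b u k} (d : Descent b u k) → Walk u (edges d)
  edges-walk stop         = []
  edges-walk (step j _ d) = j ∷ edges-walk d

  edges-decreasing : ∀ {b u k} (d : Descent b u k) → StrictlyDecreasing w (edges d)
  edges-decreasing stop                              = []
  edges-decreasing (step _ _ stop)                   = [-]
  edges-decreasing (step _ _ d@(step _ e′<e _)) = e′<e ∷ edges-decreasing d

  descent⇒decreasing : ∀ {b u k} → Descent b u k → HasDecreasing w k
  descent⇒decreasing d =
    edges d , decreasing⇒trail w (edges-walk d) (edges-decreasing d) , edges-decreasing d , edges-length d

  fromWalk : ∀ {b u e es} → Walk u (e ∷ es) → StrictlyDecreasing w (e ∷ es) → w e < b →
             Descent b u (suc (length es))
  fromWalk {e = e} (j ∷ []) _ e<b = step {e = e} j e<b stop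
  fromWalk {e = e} (j ∷ p@(_ ∷ _)) (e′<e ∷ dec) e<b = step {e = e} j e<b (fromWalk p dec e′<e)

  -- Since weights are at most `q`, the strict bound `suc q` leaves the first edge unrestricted.
  decreasing⇒descent : ∀ {q} → (∀ e → w e ≤ q) → ∀ {k} → HasDecreasing w k → ∃[ u ] Descent (suc q) u k
  decreasing⇒descent w≤q (es , trail , dec , refl) with es | walk trail | dec
  ... | []    | u , _ | _   = u , stop
  ... | e ∷ _ | u , p | dec = u , fromWalk p dec (s≤s (w≤q e))

  longestDecreasing : 1 ≤ n → ∀ {q} → (∀ e → w e ≤ q) → ∃ (Pd (K n) w)
  longestDecreasing n≥1 {q} w≤q with
    m , max ← greatest (λ k → any? λ u → descent? (suc q) u k) (suc q)
                -- The empty descent makes the set of lengths nonempty; `n≥1` supplies its vertex.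
                (λ { k (_ , d) → descent-≤ d }) (0 , fromℕ< n≥1 , stop)
    = m , IsGreatest-resp (descent⇒decreasing ∘ proj₂) (decreasing⇒descent w≤q) max

  Pd? : 1 ≤ n → ∀ {q} → (∀ e → w e ≤ q) → Decidable (Pd (K n) w)
  Pd? n≥1 w≤q k with m , max ← longestDecreasing n≥1 w≤q =
    map′ (λ { refl → max }) (IsGreatest-unique max) (m ≟ k)

-- The walking pedestrians

module Pedestrians {n : ℕ} (M : Fin n → Fin n → ℕ) (M-sym : ∀ u v → M u v ≡ M v u)
                   (M-injective : ∀ u {v v′} → M u v ≡ M u v′ → v ≡ v′) where

  neighbour? : ∀ t v → Dec (∃[ u ] M v u ≡ t)
  neighbour? t v = any? λ u → M v u ≟ t

  -- A vertex that is no end of the edge called at time `t` stays fixed.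
  swap : ℕ → Fin n → Fin n
  swap t v with neighbour? t v
  ... | yes (u , _) = u
  ... | no _        = v

  -- By symmetry `v` is a `t`-neighbour of its own `t`-neighbour, and by row injectivity it is the
  -- only one. Hence `swap t v` is also where the pedestrian now at `v` came from.
  swap-involutive : ∀ t v → swap t (swap t v) ≡ v
  swap-involutive t v with neighbour? t v in eq
  swap-involutive t v | yes (u , Mvu≡t) with neighbour? t u
  ... | yes (v′ , Muv′≡t) = M-injective u (trans Muv′≡t (trans (sym Mvu≡t) (M-sym v u)))
  ... | no ¬nbr           = contradiction (v , trans (M-sym u v) Mvu≡t) ¬nbr
  swap-involutive t v | no _ rewrite eq = refl

  swap-permutation : ℕ → Permutation′ n
  swap-permutation t = permutation (swap t) (swap t) (swap-involutive t) (swap-involutive t)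

  -- The number of steps taken before time t by the pedestrian who is then at v.
  steps : ℕ → Fin n → ℕ
  steps zero    v = 0
  steps (suc t) v = 𝟙 (neighbour? t v) + steps t (swap t v)

  -- Counts the entries in row `v` called before time `t`, the diagonal one included.
  degree : ℕ → Fin n → ℕ
  degree t v = sum λ u → 𝟙 (M v u <? t)

  -- Row injectivity lets at most one entry of row `v` equal `t`, and such an entry is what
  -- `neighbour?` detects.
  degree-suc : ∀ t v → degree (suc t) v ≤ 𝟙 (neighbour? t v) + degree t v
  degree-suc t v with neighbour? t v
  ... | yes (u , Mvu≡t) = sum-≤-suc u (≤-trans (𝟙≤1 _) (s≤s z≤n)) λ u′ u′≢u →
    𝟙-mono λ Mvu′≤t → ≤∧≢⇒< (s≤s⁻¹ Mvu′≤t) λ Mvu′≡t →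
      u′≢u (M-injective v (trans Mvu′≡t (sym Mvu≡t)))
  ... | no ¬nbr = sum-mono-≤ λ u →
    𝟙-mono λ Mvu≤t → ≤∧≢⇒< (s≤s⁻¹ Mvu≤t) λ Mvu≡t → ¬nbr (u , Mvu≡t)

  -- In each round both totals are raised by the called vertices, the degrees by no more than that;
  -- moving the pedestrians only permutes the steps already taken.
  ∑degree≤∑steps : ∀ t → sum (degree t) ≤ sum (steps t)
  ∑degree≤∑steps zero    = sum-mono-≤ {f = degree 0} {steps 0} λ v → ≤-reflexive (sum-replicate-zero n)
  ∑degree≤∑steps (suc t) = begin
    sum (degree (suc t))                        ≤⟨ sum-mono-≤ (degree-suc t) ⟩
    sum (λ v → called v + degree t v)           ≡⟨ ∑-distrib-+ called (degree t) ⟩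
    sum called + sum (degree t)                 ≤⟨ +-monoʳ-≤ (sum called) (∑degree≤∑steps t) ⟩
    sum called + sum (steps t)                  ≡⟨ cong (sum called +_) (sum-permute (steps t) (swap-permutation t)) ⟩
    sum called + sum (steps t ∘ swap t)         ≡⟨ ∑-distrib-+ called (steps t ∘ swap t) ⟨
    sum (steps (suc t))                         ∎
    where
    open ≤-Reasoning
    called = λ v → 𝟙 (neighbour? t v)

  -- Once `t` exceeds all entries, every row counts in full and each degree is `n`; by averaging,
  -- some pedestrian has taken at least that many steps.
  manySteps : 1 ≤ n → ∀ {t} → (∀ u v → M u v < t) → ∃[ v ] n ≤ steps t v
  manySteps n≥1 {t} M<t with v , deg≤ ← sum-≤⇒∃≤ n≥1 (∑degree≤∑steps t) =
    v , ≤-trans (full (M<t v)) deg≤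
    where
    full : ∀ {m} {f : Fin m → ℕ} → (∀ u → f u < t) → m ≤ sum λ u → 𝟙 (f u <? t)
    full {zero}  f<t = z≤n
    full {suc m} {f} f<t with f Fin.zero <? t
    ... | yes _   = s≤s (full (f<t ∘ Fin.suc))
    ... | no f0≮t = contradiction (f<t Fin.zero) f0≮t

-- Long decreasing trails from the pedestrians

module _ {n : ℕ} (W : WeightFunction n) where

  open WeightFunction W using (positive; bounded; injective)

  private w = weight W

  open Pedestrians (matrix w) (matrix-sym w) (matrix-injective w positive injective)

  -- The diagonal of the matrix makes every pedestrian take one idle step at
  -- time 0.
  steps-descent : ∀ t v → ∃[ k ] Descent w t v k × steps t v ≤ suc k
  steps-descent zero    v = 0 , stop , z≤n
  steps-descent (suc t) v with neighbour? t v
  ... | no _ with k , d , steps≤ ← steps-descent t v = k , descent-weaken w (n≤1+n t) d , steps≤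
  ... | yes (u , M≡t) with matrix-view w v u
  ...   | inj₁ (_ , M≡0) with refl ← trans (sym M≡t) M≡0 = 0 , stop , ≤-refl
  -- The walk is read backwards in time: the latest edge, of weight `t`, goes in front of a descent
  -- whose weights are below `t`.
  ...   | inj₂ (e , j , M≡w) with k , d , steps≤ ← steps-descent t u =
    suc k , step {e = e} j (s≤s (≤-reflexive w≡t)) (subst (λ b → Descent w b u k) (sym w≡t) d) , s≤s steps≤
    where w≡t = trans (sym M≡w) M≡t

  longDecreasing : 1 ≤ n → ∃[ k ] HasDecreasing w k × n ∸ 1 ≤ k
  longDecreasing n≥1 =
    let v , n≤steps    = manySteps n≥1 (λ u v → s≤s (matrix-≤ w bounded u v))
        k , d , steps≤ = steps-descent _ v
    in k , descent⇒decreasing w d , ∸-monoˡ-≤ 1 (≤-trans n≤steps steps≤)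

-- Searching through all weight functions

module _ {n : ℕ} where

  private q = n * (n ∸ 1) / 2

  -- Numbers the `n` by `n` tables with entries in `0..q`, which turns the search over weight
  -- functions into a search over a finite type.
  Code : Set
  Code = Fin (suc q ^ (n * n))

  decode : Code → Edge (K n) → ℕ
  decode c e = toℕ (finToFun c (combine (Edge.lo e) (Edge.hi e)))

  decode-≤ : ∀ c e → decode c e ≤ q
  decode-≤ c e = s≤s⁻¹ (toℕ<n (finToFun c (combine (Edge.lo e) (Edge.hi e))))

  encode : (w : Edge (K n) → ℕ) → (∀ e → w e ≤ q) → Code
  encode w w≤q = funToFin λ i → fromℕ< (s≤s (uncurry (matrix-≤ w w≤q) (remQuot n i)))

  decode-encode : ∀ w w≤q → decode (encode w w≤q) ≗ w
  decode-encode w w≤q e = begin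
    decode (encode w w≤q) e                    ≡⟨ cong toℕ (finToFun-funToFin _ (combine lo hi)) ⟩
    toℕ (fromℕ< (s≤s (uncurry (matrix-≤ w w≤q) (remQuot n (combine lo hi)))))
                                               ≡⟨ toℕ-fromℕ< _ ⟩
    uncurry (matrix w) (remQuot n (combine lo hi))
                                               ≡⟨ cong (uncurry (matrix w)) (remQuot-combine lo hi) ⟩
    matrix w lo hi                             ≡⟨ matrix-joins w e (inj₁ (refl , refl)) ⟩
    w e                                        ∎
    where
    open ≡-Reasoning
    open Edge e using (lo; hi)

  -- The conditions on a weight function that a code can violate; the upper bound is built into the
  -- table entries.
  Valid : (Edge (K n) → ℕ) → Set
  Valid w = (∀ e → 1 ≤ w e) × (∀ e e′ → w e ≡ w e′ → e ≡ e′)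

  valid? : ∀ w → Dec (Valid w)
  valid? w = allEdges? (λ e → 1 ≤? w e)
    ×-dec allEdges? (λ e → allEdges? λ e′ → (w e ≟ w e′) →-dec (e ≟ᴱ e′))

  -- Every weight function agrees pointwise with a decoded table, so `P-resp` carries `P` over to a
  -- code that the search meets.
  anyWeight? : (P : (Edge (K n) → ℕ) → Set) → (∀ w → (∀ e → w e ≤ q) → Dec (P w)) →
               (∀ {w w′} → w ≗ w′ → P w → P w′) → Dec (∃[ W ] P (weight {n} W))
  anyWeight? P P? P-resp = map′ fromCode toCode
    (any? λ c → valid? (decode c) ×-dec P? (decode c) (decode-≤ c))
    where
    fromCode : (∃[ c ] Valid (decode c) × P (decode c)) → ∃[ W ] P (weight {n} W)
    fromCode (c , (pos , inj) , Pc) =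
      record { weight = decode c ; positive = pos ; bounded = decode-≤ c ; injective = inj _ _ } , Pc

    toCode : (∃[ W ] P (weight {n} W)) → ∃[ c ] Valid (decode c) × P (decode c)
    toCode (W , PW) = encode w bounded ,
      ( (λ e → subst (1 ≤_) (sym (same e)) (positive e))
      , (λ e e′ eq → injective (trans (sym (same e)) (trans eq (same e′)))) )
      , P-resp (sym ∘ same) PW
      where
      open WeightFunction W using (positive; bounded; injective)
      w = weight W
      same = decode-encode w bounded

  Pd-resp : ∀ {k} {w w′ : Edge (K n) → ℕ} → w ≗ w′ → Pd (K n) w k → Pd (K n) w′ k
  Pd-resp w≗w′ = IsGreatest-resp (transport w≗w′) (transport (sym ∘ w≗w′))
    where
    transport : ∀ {k w w′} → w ≗ w′ → HasDecreasing w k → HasDecreasing w′ k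
    transport w≗w′ (es , trail , dec , len) =
      es , trail , Linked.map (λ {e} {e′} → subst₂ _>_ (w≗w′ e) (w≗w′ e′)) dec , len

-- Numbering the edges column by column

-- The binomial coefficient `h` choose 2: the number of pairs `l < h′` with `h′ < h`, hence the
-- offset at which column `h` starts.
triangle : ℕ → ℕ
triangle zero    = 0
triangle (suc h) = h + triangle h

triangle-mono : ∀ {h k} → h ≤ k → triangle h ≤ triangle k
triangle-mono {k = k} z≤n       = z≤n
triangle-mono         (s≤s h≤k) = +-mono-≤ h≤k (triangle-mono h≤k)

triangle-double : ∀ n → triangle n * 2 ≡ n * (n ∸ 1)
triangle-double zero          = refl
triangle-double (suc zero)    = refl
triangle-double (suc (suc h)) = begin
  (suc h + triangle (suc h)) * 2       ≡⟨ *-distribʳ-+ 2 (suc h) (triangle (suc h)) ⟩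
  suc h * 2 + triangle (suc h) * 2     ≡⟨ cong (suc h * 2 +_) (triangle-double (suc h)) ⟩
  suc h * 2 + suc h * h                ≡⟨ lemma h ⟩
  suc (suc h) * suc h                  ∎
  where
  open ≡-Reasoning
  lemma : ∀ h → suc h * 2 + suc h * h ≡ suc (suc h) * suc h
  lemma = solve-∀

triangle-closed : ∀ n → triangle n ≡ n * (n ∸ 1) / 2
triangle-closed n = trans (sym (m*n/n≡m (triangle n) 2)) (cong (_/ 2) (triangle-double n))

-- Column `h` has `h` entries and therefore ends before `triangle (suc h)`, the start of the next
-- column.
pair-< : ∀ {l h h′} → l < h → h < h′ → l + triangle h < triangle h′
pair-< {h = h} l<h h<h′ = <-≤-trans (+-monoˡ-< (triangle h) l<h) (triangle-mono h<h′)

pair-injective : ∀ {l h l′ h′} → l < h → l′ < h′ →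
                 l + triangle h ≡ l′ + triangle h′ → l ≡ l′ × h ≡ h′
pair-injective {l} {h} {l′} {h′} l<h l′<h′ eq with <-cmp h h′
... | tri< h<h′ _ _ = contradiction eq (<⇒≢ (<-≤-trans (pair-< l<h h<h′) (m≤n+m _ l′)))
... | tri> _ _ h′<h = contradiction (sym eq) (<⇒≢ (<-≤-trans (pair-< l′<h′ h′<h) (m≤n+m _ l)))
... | tri≈ _ refl _ = +-cancelʳ-≡ (triangle h) l l′ eq , refl

columnwise : ∀ n → WeightFunction n
columnwise n = record
  -- The numbering starts at 0 and the weights at 1.
  { weight    = λ e → suc (number e)
  ; positive  = λ _ → s≤s z≤n
  ; bounded   = λ e → subst (number e <_) (triangle-closed n) (pair-< (lo<hi e) (toℕ<n (Edge.hi e)))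
  ; injective = λ {e} {e′} eq → same-ends (pair-injective (lo<hi e) (lo<hi e′) (suc-injective eq))
  }
  where
  number : Edge (K n) → ℕ
  number e = toℕ (Edge.lo e) + triangle (toℕ (Edge.hi e))

  same-ends : ∀ {e e′ : Edge (K n)} → toℕ (Edge.lo e) ≡ toℕ (Edge.lo e′) ×
              toℕ (Edge.hi e) ≡ toℕ (Edge.hi e′) → e ≡ e′
  same-ends (lo≡ , hi≡) with refl ← toℕ-injective lo≡ | refl ← toℕ-injective hi≡ = refl

-- Existence of the minima and the lower bound

fd-exists : ∀ n → 1 ≤ n → ∃ (fd n)
fd-exists n n≥1 = least
  (λ k → anyWeight? (λ w → Pd (K n) w k) (λ w w≤q → Pd? w n≥1 w≤q k) Pd-resp)
  -- The search for the least value needs one attained value, which the column numbering provides.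
  _ (columnwise n , proj₂ (longestDecreasing _ n≥1 (WeightFunction.bounded (columnwise n))))

-- For each fixed weight function, reversal matches increasing and decreasing trails of equal
-- length, so both minima range over the same values.
fd⇒fᵢ : ∀ {n m} → fd n m → fᵢ n m
fd⇒fᵢ {n} = IsLeast-resp
  (λ { (W , Pk) → W , IsGreatest-resp (decreasing⇒increasing (weight W))
                                      (increasing⇒decreasing (weight W)) Pk })
  (λ { (W , Pk) → W , IsGreatest-resp (increasing⇒decreasing (weight W))
                                      (decreasing⇒increasing (weight W)) Pk })

corollary2 : (n : ℕ) → n ≥ 1 →
    ((w : WeightFunction n) →
    (∃[ es ] IsTrail {G = K n} es × StrictlyDecreasing (weight w) es × length es ≥ n ∸ 1)
    × (∃[ es ] IsTrail {G = K n} es × StrictlyIncreasing (weight w) es × length es ≥ n ∸ 1))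
    × (∃[ m ] fᵢ n m × fd n m × m ≥ n ∸ 1)
corollary2 n n≥1 = longTrails , minimum
  where
  atLeast : ∀ {S : List (Edge (K n)) → Set} {k} → n ∸ 1 ≤ k →
            (∃[ es ] IsTrail es × S es × length es ≡ k) →
            ∃[ es ] IsTrail {G = K n} es × S es × length es ≥ n ∸ 1
  atLeast n-1≤k (es , trail , mono , refl) = es , trail , mono , n-1≤k

  longTrails : (w : WeightFunction n) → _
  longTrails w =
    let k , dec , n-1≤k = longDecreasing w n≥1
    in atLeast n-1≤k dec , atLeast n-1≤k (decreasing⇒increasing (weight w) dec)

  minimum : ∃[ m ] fᵢ n m × fd n m × m ≥ n ∸ 1
  minimum =
    let m , isLeast@((w , _ , max) , _) = fd-exists n n≥1
        -- Here `w` attains the minimum `m`, so its own long decreasing trail has length at most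
        -- `m`.
        k , dec , n-1≤k = longDecreasing w n≥1
    in m , fd⇒fᵢ isLeast , isLeast , ≤-trans n-1≤k (max k dec)
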